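{- Let $n\ge 6$. For every $n$-vertex graph $G$, $$av_1(G)\le \frac n2+1,$$ with equality if and only if $G=K_2\cup(n-2)K_1$, i.e. $G$ consists of a single edge together with $n-2$ isolated vertices.
   Context: All graphs are finite and simple. For a graph $G=(V,E)$, a set $S\subseteq V$ is a $1$-nearly independent vertex set if the subgraph induced by $S$ has exactly one edge. $\sigma_1(G)$ is the number of such sets, $S_1(G)$ the sum of their sizes, and $av_1(G)=S_1(G)/\sigma_1(G)$, with $av_1(G)=0$ when $G$ has no edges. -}

module Defs where

open import Data.Nat using (ℕ; zero; suc; _+_; _*_)
import Data.Nat as ℕ
open import Data.Integer using (+_)
open import Data.Rational using (ℚ; 0ℚ; _/_)
open import Data.Fin using (Fin; splitAt)
import Data.Fin as Fin
open import Data.Fin.Properties using (_<?_) renaming (_≟_ to _≟ᶠ_)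
open import Data.Fin.Subset using (Subset; inside; outside; _∈_; ∣_∣)
open import Data.Fin.Subset.Properties using (_∈?_)
open import Data.List using (List; []; _∷_; _++_; map; filter; length; allFin; cartesianProduct)
open import Data.Nat.ListAction using (sum)
open import Data.Vec using ([]; _∷_)
open import Data.Product using (_×_; _,_)
open import Data.Sum.Relation.Binary.Pointwise
  using (Pointwise; ⊎-symmetric; ⊎-irreflexive; ⊎-decidable; ≡⇒Pointwise-≡)
open import Function using (_on_; _∘_)
open import Function.Bundles using (_↔_; _⇔_; Inverse)
open import Level using (0ℓ)
open import Relation.Binary using (Rel; Decidable; Symmetric; Irreflexive)
open import Relation.Binary.PropositionalEquality using (_≡_; _≢_; sym; cong)
import Relation.Unary as U
open import Relation.Nullary using (¬?; _×-dec_)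

record Graph (n : ℕ) : Set₁ where
  field
    Adj    : Rel (Fin n) 0ℓ
    adj?   : Decidable Adj
    symm   : Symmetric Adj
    irrefl : Irreflexive _≡_ Adj

open Graph public

-- Each undirected edge is listed exactly once, as its pair (i , j) with i < j.
IsEdge : ∀ {n} → Graph n → Fin n × Fin n → Set
IsEdge G (i , j) = (i Fin.< j) × Adj G i j

isEdge? : ∀ {n} (G : Graph n) → U.Decidable (IsEdge G)
isEdge? G (i , j) = (i <? j) ×-dec adj? G i j

edges : ∀ {n} → Graph n → List (Fin n × Fin n)
edges {n} G = filter (isEdge? G) (cartesianProduct (allFin n) (allFin n))

-- The edges of the subgraph of G induced by S.
inducedEdges : ∀ {n} → Graph n → Subset n → List (Fin n × Fin n)
inducedEdges G S = filter (λ (i , j) → (i ∈? S) ×-dec (j ∈? S)) (edges G)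

NearlyIndependent₁ : ∀ {n} → Graph n → Subset n → Set
NearlyIndependent₁ G S = length (inducedEdges G S) ≡ 1

nearlyIndependent₁? : ∀ {n} (G : Graph n) → U.Decidable (NearlyIndependent₁ G)
nearlyIndependent₁? G S = length (inducedEdges G S) ℕ.≟ 1

allSubsets : ∀ n → List (Subset n)
allSubsets zero    = [] ∷ []
allSubsets (suc n) = map (outside ∷_) (allSubsets n) ++ map (inside ∷_) (allSubsets n)

nearlyIndependentSets₁ : ∀ {n} → Graph n → List (Subset n)
nearlyIndependentSets₁ {n} G = filter (nearlyIndependent₁? G) (allSubsets n)

σ₁ : ∀ {n} → Graph n → ℕ
σ₁ G = length (nearlyIndependentSets₁ G)

S₁ : ∀ {n} → Graph n → ℕ
S₁ G = sum (map ∣_∣ (nearlyIndependentSets₁ G))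

average : (total count : ℕ) → ℚ
average total zero    = 0ℚ
average total (suc k) = + total / suc k

-- σ₁ G is zero exactly when G has no edges (the two ends of an edge form a
-- 1-nearly independent set), so the convention av₁ G = 0 for edgeless G is the
-- zero case of average.
av₁ : ∀ {n} → Graph n → ℚ
av₁ G = average (S₁ G) (σ₁ G)

complete : ∀ n → Graph n
complete n = record
  { Adj    = _≢_
  ; adj?   = λ i j → ¬? (i ≟ᶠ j)
  ; symm   = λ i≢j → i≢j ∘ sym
  ; irrefl = λ i≡j i≢j → i≢j i≡j
  }

infixr 6 _∪_
infixr 7 _·_
infix  4 _≅_

-- Disjoint union: the first m vertices carry G, the remaining k carry H.
_∪_ : ∀ {m k} → Graph m → Graph k → Graph (m + k)
_∪_ {m} G H = record
  { Adj    = Pointwise (Adj G) (Adj H) on splitAt m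
  ; adj?   = λ i j → ⊎-decidable (adj? G) (adj? H) (splitAt m i) (splitAt m j)
  ; symm   = ⊎-symmetric (symm G) (symm H)
  ; irrefl = λ i≡j → ⊎-irreflexive (irrefl G) (irrefl H)
                       (≡⇒Pointwise-≡ (cong (splitAt m) i≡j))
  }

_·_ : ∀ {m} k → Graph m → Graph (k * m)
zero  · G = complete 0
suc k · G = G ∪ (k · G)

record _≅_ {m n} (G : Graph m) (H : Graph n) : Set where
  field
    vertices : Fin m ↔ Fin n
    adj-⇔    : ∀ i j → Adj G i j ⇔ Adj H (Inverse.to vertices i) (Inverse.to vertices j)

{-# OPTIONS --safe #-}
-- In a 1-nearly independent set S with edge uv, removing a vertex x ∈ S keeps the
-- set 1-nearly independent exactly when x ∉ {u , v}, so |S| = 2 + #{x ∈ S : S - x ∈ F},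
-- F being the family of 1-nearly independent sets.  Summing over S ∈ F and counting the
-- pairs (S , S - x) from the side of T = S - x gives
--   2 S₁ + #{(T , x) : T ∈ F, x ∉ T, T + x ∉ F} = (n + 2) σ₁.
-- This is the inequality, and equality means that F is closed under adding vertices.
-- For nonempty F this says that the whole vertex set lies in F, i.e. G has one edge.
module Submission where

open import Defs
open import Data.Nat using (ℕ; _∸_) renaming (_≤_ to _≤ℕ_)
open import Data.Integer using (+_)
open import Data.Rational using (_/_; _+_; _≤_; 1ℚ)
open import Data.Product using (_×_)
open import Function.Bundles using (_⇔_)
open import Relation.Binary.PropositionalEquality using (_≡_)

open import Data.Bool using (Bool; true; false; if_then_else_)
open import Data.Fin using (Fin; zero; suc)
import Data.Fin as Fin
import Data.Fin.Properties as Fin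
open import Data.Fin.Permutation using (Permutation; _∘ₚ_; transpose; _⟨$⟩ʳ_)
open import Data.Fin.Subset using (Subset; inside; outside; _∈_; _⊆_; ∣_∣; ⊤)
open import Data.Fin.Subset.Properties using (_∈?_; ∈⊤; ⊆⊤)
import Data.Integer as ℤ
import Data.Integer.Properties as ℤ
open import Data.List using (List; []; _∷_; _++_; filter; length; map; allFin; cartesianProduct)
import Data.List.Membership.Propositional as L
import Data.List.Membership.Propositional.Properties as L
open import Data.List.Properties using (map-∘; map-++; map-cong)
open import Data.List.Relation.Unary.All using (_∷_)
open import Data.List.Relation.Unary.AllPairs using (_∷_)
open import Data.List.Relation.Unary.Any using (here; there)
open import Data.List.Relation.Unary.Unique.Propositional using (Unique)
import Data.List.Relation.Unary.Unique.Propositional.Properties as Unique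
open import Data.Nat using (zero; suc; s≤s)
import Data.Nat as ℕ
open import Data.Nat.ListAction using (sum)
open import Data.Nat.ListAction.Properties using (sum-++)
import Data.Nat.Properties as ℕ
open import Data.Nat.Tactic.RingSolver using (solve-∀)
open import Data.Product using (_,_; proj₁; proj₂; ∃; ∃₂)
open import Data.Rational using (toℚᵘ)
import Data.Rational.Properties as ℚ
open import Data.Rational.Unnormalised using (mkℚᵘ; *≡*; *≤*)
import Data.Rational.Unnormalised as ℚᵘ
import Data.Rational.Unnormalised.Properties as ℚᵘ
open import Data.Sum using (_⊎_; inj₁; inj₂)
open import Data.Sum.Relation.Binary.Pointwise using (inj₁; inj₂)
open import Data.Vec using ([]; _∷_; lookup; _[_]≔_)
open import Data.Vec.Properties
  using (lookup∘update; lookup∘update′; []=⇒lookup; lookup⇒[]=)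
open import Function using (_∘_; Injective)
open import Function.Bundles using (Injection; Inverse; Equivalence; mk⇔)
open import Function.Properties.Inverse using (↔⇒↣)
open import Relation.Binary using (tri<; tri≈; tri>)
open import Relation.Binary.PropositionalEquality
  using (_≢_; refl; sym; trans; cong; cong₂; subst; module ≡-Reasoning)
open import Relation.Nullary using (Dec; yes; no; does; ¬_; contradiction; _×-dec_)
open import Relation.Nullary.Decidable using (dec-true; dec-false)
import Relation.Unary as U

open import Algebra.Properties.CommutativeMonoid.Sum ℕ.+-0-commutativeMonoid
  using (∑-distrib-+; sum-cong-≗; sum-replicate-zero; sum-syntax)

private variable
  A : Set
  P : Set
  m n : ℕ

𝟙 : Dec P → ℕ
𝟙 p? = if does p? then 1 else 0

𝟙-yes : (p? : Dec P) → P → 𝟙 p? ≡ 1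
𝟙-yes p? p = cong (if_then 1 else 0) (dec-true p? p)

𝟙-no : (p? : Dec P) → ¬ P → 𝟙 p? ≡ 0
𝟙-no p? ¬p = cong (if_then 1 else 0) (dec-false p? ¬p)

-- Sums over lists and over Fin n

sum-map-+ : (f g : A → ℕ) (xs : List A) →
  sum (map (λ x → f x ℕ.+ g x) xs) ≡ sum (map f xs) ℕ.+ sum (map g xs)
sum-map-+ f g []       = refl
sum-map-+ f g (x ∷ xs) rewrite sum-map-+ f g xs =
  +-interchange (f x) (g x) (sum (map f xs)) (sum (map g xs))
  where
  +-interchange : ∀ a b c d → a ℕ.+ b ℕ.+ (c ℕ.+ d) ≡ a ℕ.+ c ℕ.+ (b ℕ.+ d)
  +-interchange = solve-∀

sum-map-* : (f : A → ℕ) (c : ℕ) (xs : List A) →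
  sum (map (λ x → f x ℕ.* c) xs) ≡ sum (map f xs) ℕ.* c
sum-map-* f c []       = refl
sum-map-* f c (x ∷ xs) rewrite sum-map-* f c xs =
  sym (ℕ.*-distribʳ-+ c (f x) (sum (map f xs)))

sum-map-cong : {f g : A → ℕ} → (∀ x → f x ≡ g x) → (xs : List A) →
  sum (map f xs) ≡ sum (map g xs)
sum-map-cong f≗g xs = cong sum (map-cong f≗g xs)

sum-map-zero : (xs : List A) → sum (map (λ _ → 0) xs) ≡ 0
sum-map-zero []       = refl
sum-map-zero (x ∷ xs) = sum-map-zero xs

sum-map≡0⇒≡0 : (f : A → ℕ) {xs : List A} {x : A} → x L.∈ xs → sum (map f xs) ≡ 0 → f x ≡ 0
sum-map≡0⇒≡0 f (here refl)               eq = ℕ.m+n≡0⇒m≡0 _ eq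
sum-map≡0⇒≡0 f {xs = y ∷ _} (there x∈xs) eq = sum-map≡0⇒≡0 f x∈xs (ℕ.m+n≡0⇒n≡0 (f y) eq)

module _ {P : A → Set} (P? : U.Decidable P) where

  sum-map-filter : (f : A → ℕ) (xs : List A) →
    sum (map f (filter P? xs)) ≡ sum (map (λ x → 𝟙 (P? x) ℕ.* f x) xs)
  sum-map-filter f []       = refl
  sum-map-filter f (x ∷ xs) with does (P? x)
  ... | true  = cong₂ ℕ._+_ (sym (ℕ.*-identityˡ (f x))) (sum-map-filter f xs)
  ... | false = sum-map-filter f xs

  length-filter : (xs : List A) → length (filter P? xs) ≡ sum (map (λ x → 𝟙 (P? x)) xs)
  length-filter []       = refl
  length-filter (x ∷ xs) with does (P? x)
  ... | true  = cong suc (length-filter xs)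
  ... | false = length-filter xs

sum-swap : (f : A → Fin n → ℕ) (xs : List A) →
  sum (map (λ a → ∑[ x < n ] f a x) xs) ≡ ∑[ x < n ] sum (map (λ a → f a x) xs)
sum-swap {n = n} f []       = sym (sum-replicate-zero n)
sum-swap         f (a ∷ xs) =
  trans (cong (_ ℕ.+_) (sum-swap f xs)) (sym (∑-distrib-+ (f a) _))

∑-zero : {f : Fin n → ℕ} → (∀ x → f x ≡ 0) → ∑[ x < n ] f x ≡ 0
∑-zero {n} f≗0 = trans (sum-cong-≗ f≗0) (sum-replicate-zero n)

∑≡0⇒≡0 : (f : Fin n → ℕ) → ∑[ x < n ] f x ≡ 0 → ∀ x → f x ≡ 0
∑≡0⇒≡0 f eq zero    = ℕ.m+n≡0⇒m≡0 (f zero) eq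
∑≡0⇒≡0 f eq (suc x) = ∑≡0⇒≡0 (f ∘ suc) (ℕ.m+n≡0⇒n≡0 (f zero) eq) x

∑-one : ∀ n → ∑[ x < n ] 1 ≡ n
∑-one zero    = refl
∑-one (suc n) = cong suc (∑-one n)

∑-𝟙≟ : (u : Fin n) → ∑[ x < n ] 𝟙 (x Fin.≟ u) ≡ 1
∑-𝟙≟ {suc n} zero = cong suc (∑-zero {n} (λ _ → refl))
∑-𝟙≟ (suc u)      = ∑-𝟙≟ u

∣∣≡∑ : (S : Subset n) → ∣ S ∣ ≡ ∑[ x < n ] (if lookup S x then 1 else 0)
∣∣≡∑ []            = refl
∣∣≡∑ (inside  ∷ S) = cong suc (∣∣≡∑ S)
∣∣≡∑ (outside ∷ S) = ∣∣≡∑ S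

-- Families of subsets

∈-allSubsets : (S : Subset n) → S L.∈ allSubsets n
∈-allSubsets []            = here refl
∈-allSubsets (outside ∷ S) = L.∈-++⁺ˡ (L.∈-map⁺ (outside ∷_) (∈-allSubsets S))
∈-allSubsets (inside  ∷ S) =
  L.∈-++⁺ʳ (map (outside ∷_) (allSubsets _)) (L.∈-map⁺ (inside ∷_) (∈-allSubsets S))

sum-allSubsets-suc : (f : Subset (suc n) → ℕ) →
  sum (map f (allSubsets (suc n))) ≡
  sum (map (f ∘ (outside ∷_)) (allSubsets n)) ℕ.+ sum (map (f ∘ (inside ∷_)) (allSubsets n))
sum-allSubsets-suc {n} f = begin
  sum (map f (map (outside ∷_) 𝒜 ++ map (inside ∷_) 𝒜))
    ≡⟨ cong sum (map-++ f (map (outside ∷_) 𝒜) _) ⟩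
  sum (map f (map (outside ∷_) 𝒜) ++ map f (map (inside ∷_) 𝒜))
    ≡⟨ sum-++ (map f (map (outside ∷_) 𝒜)) _ ⟩
  sum (map f (map (outside ∷_) 𝒜)) ℕ.+ sum (map f (map (inside ∷_) 𝒜))
    ≡⟨ cong₂ (λ xs ys → sum xs ℕ.+ sum ys) (map-∘ 𝒜) (map-∘ 𝒜) ⟨
  sum (map (f ∘ (outside ∷_)) 𝒜) ℕ.+ sum (map (f ∘ (inside ∷_)) 𝒜) ∎
  where
  open ≡-Reasoning
  𝒜 = allSubsets n

-- Removing `x` is a bijection from the sets containing `x` to the sets avoiding it; `g` receives
-- the larger set first, then the smaller. For `x = zero` this bijection matches the two halves of
-- `allSubsets`, and each side vanishes on one half.
sum-remove≡sum-add : (x : Fin n) (g : Subset n → Subset n → ℕ) →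
  sum (map (λ S → if lookup S x then g S (S [ x ]≔ outside) else 0) (allSubsets n)) ≡
  sum (map (λ S → if lookup S x then 0 else g (S [ x ]≔ inside) S) (allSubsets n))
sum-remove≡sum-add {suc n} zero g = begin
  _ ≡⟨ sum-allSubsets-suc {n} _ ⟩
  sum (map (λ _ → 0) 𝒜) ℕ.+ Σg  ≡⟨ cong (ℕ._+ Σg) (sum-map-zero 𝒜) ⟩
  Σg                            ≡⟨ ℕ.+-identityʳ Σg ⟨
  Σg ℕ.+ 0                      ≡⟨ cong (Σg ℕ.+_) (sum-map-zero 𝒜) ⟨
  Σg ℕ.+ sum (map (λ _ → 0) 𝒜)  ≡⟨ sum-allSubsets-suc {n} _ ⟨
  _ ∎
  where
  open ≡-Reasoning
  𝒜  = allSubsets n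
  Σg = sum (map (λ S → g (inside ∷ S) (outside ∷ S)) 𝒜)
sum-remove≡sum-add {suc n} (suc x) g =
  trans (sum-allSubsets-suc {n} _)
  (trans (cong₂ ℕ._+_
           (sum-remove≡sum-add x (λ S T → g (outside ∷ S) (outside ∷ T)))
           (sum-remove≡sum-add x (λ S T → g (inside ∷ S) (inside ∷ T))))
         (sym (sum-allSubsets-suc {n} _)))

-- Everything the double count uses about graphs is in `core`: each member `S` has exactly two
-- elements whose removal leaves the family.
module Family {n} {P : Subset n → Set} (P? : U.Decidable P)
  (core : ∀ S → P S → ∃₂ λ u v → u ≢ v × u ∈ S × v ∈ S ×
    ¬ P (S [ u ]≔ outside) × ¬ P (S [ v ]≔ outside) ×
    (∀ x → x ≢ u → x ≢ v → P (S [ x ]≔ outside)))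
  where

  -- `removals` and `additions` mark the same pairs of members differing in `x`, the first from the
  -- larger set and the second from the smaller. The factors come in the order that lets
  -- `sum-remove≡sum-add` apply directly. `deficit` marks the additions that leave the family.
  removals additions deficit : Subset n → Fin n → ℕ
  removals  S x = if lookup S x then 𝟙 (P? S) ℕ.* 𝟙 (P? (S [ x ]≔ outside)) else 0
  additions S x = if lookup S x then 0 else 𝟙 (P? (S [ x ]≔ inside)) ℕ.* 𝟙 (P? S)
  deficit   S x = if lookup S x then 0 else 𝟙 (P? S) ℕ.* (1 ∸ 𝟙 (P? (S [ x ]≔ inside)))

  totalDeficit : ℕ
  totalDeficit = sum (map (λ S → ∑[ x < n ] deficit S x) (allSubsets n))

  module _ (S : Subset n) where
    open ≡-Reasoning

    private
      φ        = 𝟙 (P? S)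
      Σremoved = ∑[ x < n ] removals S x

    -- In a member, `u` and `v` account for the 2 and every other element for one removal. The
    -- factor `φ` makes both sides 0 off the family, so that the identity can be summed over all
    -- subsets.
    card-removals : φ ℕ.* ∣ S ∣ ≡ φ ℕ.* 2 ℕ.+ Σremoved
    card-removals = by-cases (P? S)
      where
      no-removals : ¬ P S → ∀ x → removals S x ≡ 0
      no-removals ¬p x rewrite 𝟙-no (P? S) ¬p with lookup S x
      ... | true  = refl
      ... | false = refl

      by-cases : Dec (P S) → φ ℕ.* ∣ S ∣ ≡ φ ℕ.* 2 ℕ.+ Σremoved
      by-cases (no ¬p) rewrite ∑-zero (no-removals ¬p) | 𝟙-no (P? S) ¬p = refl
      by-cases (yes p) with core S p
      ... | u , v , u≢v , u∈S , v∈S , ¬p-u , ¬p-v , p-x = begin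
        φ ℕ.* ∣ S ∣  ≡⟨ cong (ℕ._* ∣ S ∣) φ≡1 ⟩
        1 ℕ.* ∣ S ∣  ≡⟨ ℕ.*-identityˡ ∣ S ∣ ⟩
        ∣ S ∣        ≡⟨ ∣∣≡∑ S ⟩
        ∑[ x < n ] (if lookup S x then 1 else 0)
          ≡⟨ sum-cong-≗ pointwise ⟩
        ∑[ x < n ] (δ u x ℕ.+ δ v x ℕ.+ removals S x)
          ≡⟨ ∑-distrib-+ (λ x → δ u x ℕ.+ δ v x) (removals S) ⟩
        ∑[ x < n ] (δ u x ℕ.+ δ v x) ℕ.+ Σremoved
          ≡⟨ cong (ℕ._+ Σremoved) (∑-distrib-+ (δ u) (δ v)) ⟩
        ∑[ x < n ] δ u x ℕ.+ ∑[ x < n ] δ v x ℕ.+ Σremoved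
          ≡⟨ cong (ℕ._+ Σremoved) (cong₂ ℕ._+_ (∑-𝟙≟ u) (∑-𝟙≟ v)) ⟩
        2 ℕ.+ Σremoved
          ≡⟨ cong (λ k → k ℕ.* 2 ℕ.+ Σremoved) φ≡1 ⟨
        φ ℕ.* 2 ℕ.+ Σremoved ∎
        where
        φ≡1 : φ ≡ 1
        φ≡1 = 𝟙-yes (P? S) p

        δ : Fin n → Fin n → ℕ
        δ w x = 𝟙 (x Fin.≟ w)

        pointwise : ∀ x → (if lookup S x then 1 else 0) ≡ δ u x ℕ.+ δ v x ℕ.+ removals S x
        pointwise x with x Fin.≟ u | x Fin.≟ v
        ... | yes refl | yes refl = contradiction refl u≢v
        ... | yes refl | no _
          rewrite []=⇒lookup u∈S | φ≡1 | 𝟙-no (P? (S [ u ]≔ outside)) ¬p-u = refl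
        ... | no _ | yes refl
          rewrite []=⇒lookup v∈S | φ≡1 | 𝟙-no (P? (S [ v ]≔ outside)) ¬p-v = refl
        -- Here `core` gives membership of `S [ x ]≔ outside` whether or not `x` lies in `S`, so
        -- both sides become the same conditional on `lookup S x`.
        ... | no x≢u | no x≢v
          rewrite φ≡1 | 𝟙-yes (P? (S [ x ]≔ outside)) (p-x x x≢u x≢v) = refl

    -- Each vertex is in `S`, or can be added within the family, or counts towards the deficit.
    cocard-additions : φ ℕ.* n ≡
      φ ℕ.* ∣ S ∣ ℕ.+ (∑[ x < n ] additions S x ℕ.+ ∑[ x < n ] deficit S x)
    cocard-additions = by-cases (P? S)
      where
      no-additions : ¬ P S → ∀ x → additions S x ≡ 0
      no-additions ¬p x rewrite 𝟙-no (P? S) ¬p with lookup S x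
      ... | true  = refl
      ... | false = ℕ.*-zeroʳ (𝟙 (P? (S [ x ]≔ inside)))

      no-deficit : ¬ P S → ∀ x → deficit S x ≡ 0
      no-deficit ¬p x rewrite 𝟙-no (P? S) ¬p with lookup S x
      ... | true  = refl
      ... | false = refl

      pointwise : P S → ∀ x →
        1 ≡ (if lookup S x then 1 else 0) ℕ.+ (additions S x ℕ.+ deficit S x)
      pointwise p x rewrite 𝟙-yes (P? S) p with lookup S x
      ... | true  = refl
      ... | false with P? (S [ x ]≔ inside)
      ...   | yes _ = refl
      ...   | no _  = refl

      by-cases : Dec (P S) → φ ℕ.* n ≡
        φ ℕ.* ∣ S ∣ ℕ.+ (∑[ x < n ] additions S x ℕ.+ ∑[ x < n ] deficit S x)
      by-cases (no ¬p)
        rewrite ∑-zero (no-additions ¬p) | ∑-zero (no-deficit ¬p) | 𝟙-no (P? S) ¬p = refl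
      by-cases (yes p) = begin
        φ ℕ.* n      ≡⟨ cong (ℕ._* n) φ≡1 ⟩
        1 ℕ.* n      ≡⟨ ℕ.*-identityˡ n ⟩
        n            ≡⟨ ∑-one n ⟨
        ∑[ x < n ] 1 ≡⟨ sum-cong-≗ (pointwise p) ⟩
        ∑[ x < n ] ((if lookup S x then 1 else 0) ℕ.+ (additions S x ℕ.+ deficit S x))
          ≡⟨ ∑-distrib-+ (λ x → if lookup S x then 1 else 0) _ ⟩
        ∑[ x < n ] (if lookup S x then 1 else 0) ℕ.+ ∑[ x < n ] (additions S x ℕ.+ deficit S x)
          ≡⟨ cong₂ ℕ._+_ (sym (∣∣≡∑ S)) (∑-distrib-+ (additions S) (deficit S)) ⟩
        ∣ S ∣ ℕ.+ Σ±
          ≡⟨ cong (ℕ._+ Σ±) (ℕ.*-identityˡ ∣ S ∣) ⟨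
        1 ℕ.* ∣ S ∣ ℕ.+ Σ±
          ≡⟨ cong (λ k → k ℕ.* ∣ S ∣ ℕ.+ Σ±) φ≡1 ⟨
        φ ℕ.* ∣ S ∣ ℕ.+ Σ± ∎
        where
        φ≡1 : φ ≡ 1
        φ≡1 = 𝟙-yes (P? S) p

        Σ± : ℕ
        Σ± = ∑[ x < n ] additions S x ℕ.+ ∑[ x < n ] deficit S x

  private
    𝒜 = allSubsets n
    σ = length (filter P? 𝒜)
    s = sum (map ∣_∣ (filter P? 𝒜))
    Σ⁻ = sum (map (λ S → ∑[ x < n ] removals S x) 𝒜)
    Σ⁺ = sum (map (λ S → ∑[ x < n ] additions S x) 𝒜)

  totalRemovals≡totalAdditions : Σ⁻ ≡ Σ⁺
  totalRemovals≡totalAdditions = begin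
    Σ⁻ ≡⟨ sum-swap removals 𝒜 ⟩
    ∑[ x < n ] sum (map (λ S → removals S x) 𝒜)
      ≡⟨ sum-cong-≗ (λ x → sum-remove≡sum-add x (λ S T → 𝟙 (P? S) ℕ.* 𝟙 (P? T))) ⟩
    ∑[ x < n ] sum (map (λ S → additions S x) 𝒜) ≡⟨ sum-swap additions 𝒜 ⟨
    Σ⁺ ∎
    where open ≡-Reasoning

  total-removals : s ≡ σ ℕ.* 2 ℕ.+ Σ⁻
  total-removals = begin
    s ≡⟨ sum-map-filter P? ∣_∣ 𝒜 ⟩
    sum (map (λ S → 𝟙 (P? S) ℕ.* ∣ S ∣) 𝒜) ≡⟨ sum-map-cong card-removals 𝒜 ⟩
    sum (map (λ S → 𝟙 (P? S) ℕ.* 2 ℕ.+ ∑[ x < n ] removals S x) 𝒜)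
      ≡⟨ sum-map-+ (λ S → 𝟙 (P? S) ℕ.* 2) _ 𝒜 ⟩
    sum (map (λ S → 𝟙 (P? S) ℕ.* 2) 𝒜) ℕ.+ Σ⁻
      ≡⟨ cong (ℕ._+ Σ⁻) (sum-map-* (λ S → 𝟙 (P? S)) 2 𝒜) ⟩
    sum (map (λ S → 𝟙 (P? S)) 𝒜) ℕ.* 2 ℕ.+ Σ⁻
      ≡⟨ cong (λ k → k ℕ.* 2 ℕ.+ Σ⁻) (length-filter P? 𝒜) ⟨
    σ ℕ.* 2 ℕ.+ Σ⁻ ∎
    where open ≡-Reasoning

  total-additions : σ ℕ.* n ≡ s ℕ.+ (Σ⁺ ℕ.+ totalDeficit)
  total-additions = begin
    σ ℕ.* n ≡⟨ cong (ℕ._* n) (length-filter P? 𝒜) ⟩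
    sum (map (λ S → 𝟙 (P? S)) 𝒜) ℕ.* n ≡⟨ sum-map-* (λ S → 𝟙 (P? S)) n 𝒜 ⟨
    sum (map (λ S → 𝟙 (P? S) ℕ.* n) 𝒜) ≡⟨ sum-map-cong cocard-additions 𝒜 ⟩
    sum (map (λ S → 𝟙 (P? S) ℕ.* ∣ S ∣ ℕ.+
                      (∑[ x < n ] additions S x ℕ.+ ∑[ x < n ] deficit S x)) 𝒜)
      ≡⟨ sum-map-+ (λ S → 𝟙 (P? S) ℕ.* ∣ S ∣) _ 𝒜 ⟩
    sum (map (λ S → 𝟙 (P? S) ℕ.* ∣ S ∣) 𝒜) ℕ.+
      sum (map (λ S → ∑[ x < n ] additions S x ℕ.+ ∑[ x < n ] deficit S x) 𝒜)
      ≡⟨ cong₂ ℕ._+_ (sym (sum-map-filter P? ∣_∣ 𝒜))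
                     (sum-map-+ (λ S → ∑[ x < n ] additions S x) _ 𝒜) ⟩
    s ℕ.+ (Σ⁺ ℕ.+ totalDeficit) ∎
    where open ≡-Reasoning

  -- One copy of `s` is expanded by removals, the other is completed by additions and deficit to
  -- `σ ℕ.* n`; the totals of removals and additions agree. Keeping the deficit as a summand yields
  -- both the bound and its equality case.
  double-count : s ℕ.* 2 ℕ.+ totalDeficit ≡ (n ℕ.+ 2) ℕ.* σ
  double-count = begin
    s ℕ.* 2 ℕ.+ D                    ≡⟨ split s D ⟩
    s ℕ.+ (s ℕ.+ D)                  ≡⟨ cong (ℕ._+ (s ℕ.+ D)) total-removals ⟩
    σ ℕ.* 2 ℕ.+ Σ⁻ ℕ.+ (s ℕ.+ D)      ≡⟨ cong (λ r → σ ℕ.* 2 ℕ.+ r ℕ.+ (s ℕ.+ D))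
                                             totalRemovals≡totalAdditions ⟩
    σ ℕ.* 2 ℕ.+ Σ⁺ ℕ.+ (s ℕ.+ D)      ≡⟨ regroup (σ ℕ.* 2) Σ⁺ s D ⟩
    σ ℕ.* 2 ℕ.+ (s ℕ.+ (Σ⁺ ℕ.+ D))    ≡⟨ cong (σ ℕ.* 2 ℕ.+_) total-additions ⟨
    σ ℕ.* 2 ℕ.+ σ ℕ.* n              ≡⟨ factor σ n ⟩
    (n ℕ.+ 2) ℕ.* σ ∎
    where
    open ≡-Reasoning
    D = totalDeficit

    split : ∀ a d → a ℕ.* 2 ℕ.+ d ≡ a ℕ.+ (a ℕ.+ d)
    split = solve-∀

    regroup : ∀ a b c d → a ℕ.+ b ℕ.+ (c ℕ.+ d) ≡ a ℕ.+ (c ℕ.+ (b ℕ.+ d))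
    regroup = solve-∀

    factor : ∀ a b → a ℕ.* 2 ℕ.+ a ℕ.* b ≡ (b ℕ.+ 2) ℕ.* a
    factor = solve-∀

  totalDeficit≡0⇒addition-closed : totalDeficit ≡ 0 →
    ∀ S x → lookup S x ≡ outside → P S → P (S [ x ]≔ inside)
  totalDeficit≡0⇒addition-closed D≡0 S x x∉S p
    with ∑≡0⇒≡0 (deficit S) (sum-map≡0⇒≡0 _ (∈-allSubsets S) D≡0) x
  ... | eq rewrite x∉S | 𝟙-yes (P? S) p with P? (S [ x ]≔ inside)
  -- In the other case the deficit of `S` at `x` would be 1, against `eq`.
  ...   | yes q = q

  addition-closed⇒totalDeficit≡0 :
    (∀ S x → P S → P (S [ x ]≔ inside)) → totalDeficit ≡ 0
  addition-closed⇒totalDeficit≡0 closed =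
    trans (sum-map-cong (λ S → ∑-zero (no-deficit S)) 𝒜) (sum-map-zero 𝒜)
    where
    no-deficit : ∀ S x → deficit S x ≡ 0
    no-deficit S x with lookup S x
    ... | true  = refl
    ... | false with P? S
    ...   | no _ = refl
    ...   | yes p rewrite 𝟙-yes (P? (S [ x ]≔ inside)) (closed S x p) = refl

  count≡suc⇒member : ∀ {k} → σ ≡ suc k → ∃ P
  count≡suc⇒member eq with filter P? 𝒜 in filtered
  ... | S ∷ _ = S , proj₂ (L.∈-filter⁻ P? {xs = 𝒜} (subst (S L.∈_) (sym filtered) (here refl)))

  member⇒count≢0 : ∀ {S} → P S → σ ≢ 0
  member⇒count≢0 {S} p eq with filter P? 𝒜 | L.∈-filter⁺ P? (∈-allSubsets S) p
  ... | [] | ()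

-- The missing vertices are added one at a time, first coordinate first. The predicate is arbitrary
-- so that the induction can pass to `P ∘ (inside ∷_)`.
addition-closed⇒⊤ : (P : Subset n → Set) →
  (∀ S x → lookup S x ≡ outside → P S → P (S [ x ]≔ inside)) → ∀ S → P S → P ⊤
addition-closed⇒⊤ P closed []            p = p
addition-closed⇒⊤ P closed (inside ∷ S)  p =
  addition-closed⇒⊤ (P ∘ (inside ∷_)) (λ T x → closed (inside ∷ T) (suc x)) S p
addition-closed⇒⊤ P closed (outside ∷ S) p =
  addition-closed⇒⊤ (P ∘ (inside ∷_)) (λ T x → closed (inside ∷ T) (suc x)) S
    (closed (outside ∷ S) zero refl p)

-- Membership after adding or removing one vertex

∈-remove⁻ : (S : Subset n) (x : Fin n) {y : Fin n} → y ∈ S [ x ]≔ outside → y ≢ x × y ∈ S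
∈-remove⁻ S x {y} y∈S-x = y≢x , lookup⇒[]= y S (trans (sym (lookup∘update′ y≢x S _)) eq)
  where
  eq = []=⇒lookup y∈S-x

  y≢x : y ≢ x
  y≢x refl with trans (sym (lookup∘update x S outside)) eq
  ... | ()

∈-update⁺ : (S : Subset n) {x y : Fin n} {b : Bool} → y ≢ x → y ∈ S → y ∈ S [ x ]≔ b
∈-update⁺ S {x} {y} y≢x y∈S =
  lookup⇒[]= y _ (trans (lookup∘update′ y≢x S _) ([]=⇒lookup y∈S))

⊆-add : (S : Subset n) (x : Fin n) → S ⊆ S [ x ]≔ inside
⊆-add S x {y} y∈S with y Fin.≟ x
... | yes refl = lookup⇒[]= x _ (lookup∘update x S inside)
... | no y≢x   = ∈-update⁺ S y≢x y∈S

-- Induced edges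

length≡1⇒singleton : (xs : List A) → length xs ≡ 1 → ∃ λ x → xs ≡ x ∷ []
length≡1⇒singleton (x ∷ []) refl = x , refl

unique∧all≡⇒length≡1 : {xs : List A} {x : A} → Unique xs → x L.∈ xs →
  (∀ y → y L.∈ xs → y ≡ x) → length xs ≡ 1
unique∧all≡⇒length≡1 {xs = _ ∷ []}    _               _ _   = refl
unique∧all≡⇒length≡1 {xs = y ∷ z ∷ _} ((y≢z ∷ _) ∷ _) _ all =
  contradiction (trans (all y (here refl)) (sym (all z (there (here refl))))) y≢z

InducedEdge : Graph n → Subset n → Fin n × Fin n → Set
InducedEdge G S (i , j) = (i Fin.< j) × Adj G i j × i ∈ S × j ∈ S

module _ {n} (G : Graph n) where

  private
    allPairs : List (Fin n × Fin n)
    allPairs = cartesianProduct (allFin n) (allFin n)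

    bothIn? : (S : Subset n) → U.Decidable (λ ((i , j) : Fin n × Fin n) → i ∈ S × j ∈ S)
    bothIn? S (i , j) = (i ∈? S) ×-dec (j ∈? S)

  ∈-inducedEdges⁺ : ∀ {S e} → InducedEdge G S e → e L.∈ inducedEdges G S
  ∈-inducedEdges⁺ {S} {i , j} (i<j , adj , i∈S , j∈S) =
    L.∈-filter⁺ (bothIn? S)
      (L.∈-filter⁺ (isEdge? G) (L.∈-cartesianProduct⁺ (L.∈-allFin i) (L.∈-allFin j)) (i<j , adj))
      (i∈S , j∈S)

  ∈-inducedEdges⁻ : ∀ {S e} → e L.∈ inducedEdges G S → InducedEdge G S e
  ∈-inducedEdges⁻ {S} e∈ with L.∈-filter⁻ (bothIn? S) {xs = edges G} e∈
  ... | e∈edges , i∈S , j∈S with L.∈-filter⁻ (isEdge? G) {xs = allPairs} e∈edges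
  ...   | _ , i<j , adj = i<j , adj , i∈S , j∈S

  inducedEdges-unique : ∀ S → Unique (inducedEdges G S)
  inducedEdges-unique S = Unique.filter⁺ (bothIn? S) (Unique.filter⁺ (isEdge? G)
    (Unique.cartesianProduct⁺ (Unique.allFin⁺ n) (Unique.allFin⁺ n)))

  -- With its converse below, this replaces the length of `inducedEdges` by existence and uniqueness
  -- of an induced edge. The converse rests on the list having no duplicates.
  nearlyIndependent⇒sole : ∀ {S} → NearlyIndependent₁ G S →
    ∃ λ e → InducedEdge G S e × (∀ e′ → InducedEdge G S e′ → e′ ≡ e)
  nearlyIndependent⇒sole {S} ni with length≡1⇒singleton (inducedEdges G S) ni
  ... | e , eq = e , ∈-inducedEdges⁻ (subst (e L.∈_) (sym eq) (here refl)) , sole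
    where
    sole : ∀ e′ → InducedEdge G S e′ → e′ ≡ e
    sole e′ ind with subst (e′ L.∈_) eq (∈-inducedEdges⁺ ind)
    ... | here e′≡e = e′≡e

  sole⇒nearlyIndependent : ∀ {S e} → InducedEdge G S e →
    (∀ e′ → InducedEdge G S e′ → e′ ≡ e) → NearlyIndependent₁ G S
  sole⇒nearlyIndependent ind sole = unique∧all≡⇒length≡1 (inducedEdges-unique _)
    (∈-inducedEdges⁺ ind) (λ e′ e′∈ → sole e′ (∈-inducedEdges⁻ e′∈))

  inducedEdge-⊆ : ∀ {S T e} → S ⊆ T → InducedEdge G S e → InducedEdge G T e
  inducedEdge-⊆ S⊆T (i<j , adj , i∈S , j∈S) = i<j , adj , S⊆T i∈S , S⊆T j∈S

  -- Every edge induced by `S` is induced by `T`, which has only one; so it suffices that `S` still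
  -- has an edge.
  nearlyIndependent-⊆ : ∀ {S T e} → S ⊆ T → InducedEdge G S e →
    NearlyIndependent₁ G T → NearlyIndependent₁ G S
  nearlyIndependent-⊆ S⊆T ind ni with nearlyIndependent⇒sole ni
  ... | _ , _ , sole = sole⇒nearlyIndependent ind λ e′ ind′ →
    trans (sole e′ (inducedEdge-⊆ S⊆T ind′)) (sym (sole _ (inducedEdge-⊆ S⊆T ind)))

  -- The two special elements are the ends of the sole edge: removing an end destroys that edge,
  -- removing anything else keeps it.
  nearlyIndependent-core : ∀ S → NearlyIndependent₁ G S →
    ∃₂ λ u v → u ≢ v × u ∈ S × v ∈ S ×
      ¬ NearlyIndependent₁ G (S [ u ]≔ outside) ×
      ¬ NearlyIndependent₁ G (S [ v ]≔ outside) ×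
      (∀ x → x ≢ u → x ≢ v → NearlyIndependent₁ G (S [ x ]≔ outside))
  nearlyIndependent-core S ni with nearlyIndependent⇒sole ni
  ... | (u , v) , (u<v , adj , u∈S , v∈S) , sole =
    u , v , Fin.<⇒≢ u<v , u∈S , v∈S ,
    (λ ni-u → proj₁ (∈-remove⁻ S u (proj₁ (survives u ni-u))) refl) ,
    (λ ni-v → proj₁ (∈-remove⁻ S v (proj₂ (survives v ni-v))) refl) ,
    (λ x x≢u x≢v → nearlyIndependent-⊆ (remove-⊆ x)
      (u<v , adj , ∈-update⁺ S (x≢u ∘ sym) u∈S , ∈-update⁺ S (x≢v ∘ sym) v∈S) ni)
    where
    remove-⊆ : ∀ x → S [ x ]≔ outside ⊆ S
    remove-⊆ x y∈ = proj₂ (∈-remove⁻ S x y∈)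

    -- The edge left after removing `x` is also an edge of `S`, hence is `(u , v)`, so both ends
    -- outlive the removal. Taking `x` to be an end is then absurd.
    survives : ∀ x → NearlyIndependent₁ G (S [ x ]≔ outside) →
      u ∈ S [ x ]≔ outside × v ∈ S [ x ]≔ outside
    survives x ni-x with nearlyIndependent⇒sole ni-x
    ... | e , ind@(_ , _ , i∈ , j∈) , _ with sole e (inducedEdge-⊆ (remove-⊆ x) ind)
    ...   | refl = i∈ , j∈

  -- The enlarged set keeps the edge of `S` and lies below `⊤`, which has just one edge.
  nearlyIndependent⊤⇒addition-closed : NearlyIndependent₁ G ⊤ →
    ∀ S x → NearlyIndependent₁ G S → NearlyIndependent₁ G (S [ x ]≔ inside)
  nearlyIndependent⊤⇒addition-closed ni⊤ S x ni with nearlyIndependent⇒sole ni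
  ... | _ , ind , _ = nearlyIndependent-⊆ ⊆⊤ (inducedEdge-⊆ (⊆-add S x) ind) ni⊤

  -- For this family the count and the total size in `double-count` are `σ₁ G` and `S₁ G` by
  -- definition.
  open Family (nearlyIndependent₁? G) nearlyIndependent-core public

-- Graphs with exactly one edge

-- Both orientations are listed and `u`, `v` are not ordered, unlike in `InducedEdge`, so that the
-- notion passes along bijections that ignore the order of the vertices.
IsOnlyEdge : Graph n → Fin n → Fin n → Set
IsOnlyEdge G u v = ∀ i j → Adj G i j ⇔ ((i ≡ u × j ≡ v) ⊎ (i ≡ v × j ≡ u))

module OnlyEdge {n} {G : Graph n} {u v : Fin n} (only : IsOnlyEdge G u v) where

  adjacent : Adj G u v
  adjacent = Equivalence.from (only u v) (inj₁ (refl , refl))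

  distinct : u ≢ v
  distinct u≡v = irrefl G u≡v adjacent

  ends : ∀ {i j} → Adj G i j → (i ≡ u × j ≡ v) ⊎ (i ≡ v × j ≡ u)
  ends = Equivalence.to (only _ _)

nearlyIndependent⊤⇒onlyEdge : (G : Graph n) → NearlyIndependent₁ G ⊤ → ∃₂ (IsOnlyEdge G)
nearlyIndependent⊤⇒onlyEdge G ni with nearlyIndependent⇒sole G ni
... | (u , v) , (_ , adj , _) , sole = u , v , λ i j → mk⇔ (to i j) from
  where
  to : ∀ i j → Adj G i j → (i ≡ u × j ≡ v) ⊎ (i ≡ v × j ≡ u)
  to i j a with Fin.<-cmp i j
  ... | tri≈ _ i≡j _ = contradiction a (irrefl G i≡j)
  ... | tri< i<j _ _ with refl ← sole (i , j) (i<j , a , ∈⊤ , ∈⊤) = inj₁ (refl , refl)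
  ... | tri> _ _ j<i with refl ← sole (j , i) (j<i , symm G a , ∈⊤ , ∈⊤) = inj₂ (refl , refl)

  from : ∀ {i j} → (i ≡ u × j ≡ v) ⊎ (i ≡ v × j ≡ u) → Adj G i j
  from (inj₁ (refl , refl)) = adj
  from (inj₂ (refl , refl)) = symm G adj

onlyEdge⇒nearlyIndependent⊤ : (G : Graph n) {u v : Fin n} → IsOnlyEdge G u v →
  NearlyIndependent₁ G ⊤
onlyEdge⇒nearlyIndependent⊤ G {u} {v} only with Fin.<-cmp u v
... | tri≈ _ u≡v _ = contradiction u≡v (OnlyEdge.distinct {G = G} only)
... | tri< u<v _ _ = sole⇒nearlyIndependent G
        (u<v , OnlyEdge.adjacent {G = G} only , ∈⊤ , ∈⊤) λ (i , j) → same i j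
  where
  same : ∀ i j → InducedEdge G ⊤ (i , j) → (i , j) ≡ (u , v)
  same i j (i<j , a , _) with OnlyEdge.ends {G = G} only a
  ... | inj₁ (refl , refl) = refl
  ... | inj₂ (refl , refl) = contradiction i<j (Fin.<-asym u<v)
... | tri> _ _ v<u = sole⇒nearlyIndependent G
        (v<u , symm G (OnlyEdge.adjacent {G = G} only) , ∈⊤ , ∈⊤) λ (i , j) → same i j
  where
  same : ∀ i j → InducedEdge G ⊤ (i , j) → (i , j) ≡ (v , u)
  same i j (i<j , a , _) with OnlyEdge.ends {G = G} only a
  ... | inj₁ (refl , refl) = contradiction i<j (Fin.<-asym v<u)
  ... | inj₂ (refl , refl) = refl

-- Isomorphisms of one-edge graphs

transpose-matchˡ : (i j : Fin n) → transpose i j ⟨$⟩ʳ i ≡ j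
transpose-matchˡ i j rewrite dec-true (i Fin.≟ i) refl = refl

transpose-mismatch : {i j k : Fin n} → k ≢ i → k ≢ j → transpose i j ⟨$⟩ʳ k ≡ k
transpose-mismatch {i = i} {j} {k} k≢i k≢j
  rewrite dec-false (k Fin.≟ i) k≢i | dec-false (k Fin.≟ j) k≢j = refl

permutation-injective : (π : Permutation m n) → Injective _≡_ _≡_ (π ⟨$⟩ʳ_)
permutation-injective π = Injection.injective (↔⇒↣ π)

-- A first transposition takes `u` to `u′`; a second takes the image `w` of `v` to `v′` and fixes
-- `u′`, which differs from both `w` and `v′`.
permutation-pair : m ≡ n → {u v : Fin m} {u′ v′ : Fin n} → u ≢ v → u′ ≢ v′ →
  ∃ λ (π : Permutation m n) → π ⟨$⟩ʳ u ≡ u′ × π ⟨$⟩ʳ v ≡ v′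
permutation-pair refl {u} {v} {u′} {v′} u≢v u′≢v′ =
  τ ∘ₚ transpose w v′ ,
  trans (cong (transpose w v′ ⟨$⟩ʳ_) (transpose-matchˡ u u′)) (transpose-mismatch u′≢w u′≢v′) ,
  transpose-matchˡ w v′
  where
  τ = transpose u u′
  w = τ ⟨$⟩ʳ v

  u′≢w : u′ ≢ w
  u′≢w u′≡w = u≢v (permutation-injective τ (trans (transpose-matchˡ u u′) u′≡w))

-- Any bijection taking the ends of one edge to the ends of the other works. The orders are related
-- by `m ≡ n` because the vertex count of the extremal graph is `n` only up to a proof.
onlyEdge⇒≅ : {G : Graph m} {H : Graph n} {u v : Fin m} {u′ v′ : Fin n} → m ≡ n →
  IsOnlyEdge G u v → IsOnlyEdge H u′ v′ → G ≅ H
onlyEdge⇒≅ {G = G} {H} m≡n onlyG onlyH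
  with permutation-pair m≡n (OnlyEdge.distinct {G = G} onlyG) (OnlyEdge.distinct {G = H} onlyH)
... | π , refl , refl = record { vertices = π ; adj-⇔ = λ i j → mk⇔ to from }
  where
  to : ∀ {i j} → Adj G i j → Adj H (π ⟨$⟩ʳ i) (π ⟨$⟩ʳ j)
  to a with OnlyEdge.ends {G = G} onlyG a
  ... | inj₁ (refl , refl) = OnlyEdge.adjacent {G = H} onlyH
  ... | inj₂ (refl , refl) = symm H (OnlyEdge.adjacent {G = H} onlyH)

  inj = permutation-injective π

  from : ∀ {i j} → Adj H (π ⟨$⟩ʳ i) (π ⟨$⟩ʳ j) → Adj G i j
  from a with OnlyEdge.ends {G = H} onlyH a
  ... | inj₁ (p , q) = Equivalence.from (onlyG _ _) (inj₁ (inj p , inj q))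
  ... | inj₂ (p , q) = Equivalence.from (onlyG _ _) (inj₂ (inj p , inj q))

≅⇒onlyEdge : {G : Graph m} {H : Graph n} {u v : Fin n} → G ≅ H →
  IsOnlyEdge H u v → ∃₂ (IsOnlyEdge G)
≅⇒onlyEdge {G = G} {u = u} {v} G≅H only = π.from u , π.from v , λ i j → mk⇔ (to i j) (from i j)
  where
  open _≅_ G≅H
  module π = Inverse vertices

  to : ∀ i j → Adj G i j → (i ≡ π.from u × j ≡ π.from v) ⊎ (i ≡ π.from v × j ≡ π.from u)
  to i j a with Equivalence.to (only _ _) (Equivalence.to (adj-⇔ i j) a)
  ... | inj₁ (p , q) = inj₁ (sym (π.inverseʳ (sym p)) , sym (π.inverseʳ (sym q)))
  ... | inj₂ (p , q) = inj₂ (sym (π.inverseʳ (sym p)) , sym (π.inverseʳ (sym q)))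

  from : ∀ i j → (i ≡ π.from u × j ≡ π.from v) ⊎ (i ≡ π.from v × j ≡ π.from u) → Adj G i j
  from i j (inj₁ (p , q)) = Equivalence.from (adj-⇔ i j)
    (Equivalence.from (only _ _) (inj₁ (π.inverseˡ p , π.inverseˡ q)))
  from i j (inj₂ (p , q)) = Equivalence.from (adj-⇔ i j)
    (Equivalence.from (only _ _) (inj₂ (π.inverseˡ p , π.inverseˡ q)))

isolated-edgeless : ∀ k {i j} → ¬ Adj (k · complete 1) i j
isolated-edgeless (suc k) {zero}  {zero}  (inj₁ 0≢0) = 0≢0 refl
isolated-edgeless (suc k) {suc i} {suc j} (inj₂ a)   = isolated-edgeless k a

K₂∪isolated-onlyEdge : ∀ k → IsOnlyEdge (complete 2 ∪ k · complete 1) zero (suc zero)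
K₂∪isolated-onlyEdge k i j = mk⇔ (to i j) from
  where
  H = complete 2 ∪ k · complete 1

  to : ∀ i j → Adj H i j → (i ≡ zero × j ≡ suc zero) ⊎ (i ≡ suc zero × j ≡ zero)
  to zero          zero          (inj₁ 0≢0) = contradiction refl 0≢0
  to zero          (suc zero)    _          = inj₁ (refl , refl)
  to (suc zero)    zero          _          = inj₂ (refl , refl)
  to (suc zero)    (suc zero)    (inj₁ 1≢1) = contradiction refl 1≢1
  -- Pairs with one vertex in each summand are empty cases, as `Pointwise` never relates `inj₁` to
  -- `inj₂`.
  to (suc (suc i)) (suc (suc j)) (inj₂ a)   = contradiction a (isolated-edgeless k)

  from : ∀ {i j} → (i ≡ zero × j ≡ suc zero) ⊎ (i ≡ suc zero × j ≡ zero) → Adj H i j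
  from (inj₁ (refl , refl)) = inj₁ λ ()
  from (inj₂ (refl , refl)) = inj₁ λ ()

-- The average

-- With the bound as one fraction, comparing it to `av₁` by cross-multiplication gives exactly the
-- terms of `double-count`.
+n/2+1≡+[n+2]/2 : ∀ n → + n / 2 + 1ℚ ≡ + (n ℕ.+ 2) / 2
+n/2+1≡+[n+2]/2 n = ℚ.toℚᵘ-injective (begin
  toℚᵘ (+ n / 2 + 1ℚ)            ≈⟨ ℚ.toℚᵘ-homo-+ (+ n / 2) 1ℚ ⟩
  toℚᵘ (+ n / 2) ℚᵘ.+ toℚᵘ 1ℚ    ≈⟨ ℚᵘ.+-congˡ (toℚᵘ 1ℚ) (ℚ.toℚᵘ-fromℚᵘ (mkℚᵘ (+ n) 1)) ⟩
  mkℚᵘ (+ n) 1 ℚᵘ.+ toℚᵘ 1ℚ      ≈⟨ *≡* (cong (ℤ._* + 2) (cong (ℤ._+ + 2) (ℤ.*-identityʳ (+ n)))) ⟩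
  mkℚᵘ (+ (n ℕ.+ 2)) 1           ≈⟨ ℚ.toℚᵘ-fromℚᵘ (mkℚᵘ (+ (n ℕ.+ 2)) 1) ⟨
  toℚᵘ (+ (n ℕ.+ 2) / 2)         ∎)
  where open ℚᵘ.≃-Reasoning

-- The fractions of `ℚ` are reduced to lowest terms; on unnormalised rationals the order is
-- cross-multiplication itself.
/-≤⁺ : ∀ a b c d → a ℕ.* suc d ≤ℕ c ℕ.* suc b → + a / suc b ≤ + c / suc d
/-≤⁺ a b c d ad≤cb = ℚ.toℚᵘ-cancel-≤ (begin
  toℚᵘ (+ a / suc b) ≃⟨ ℚ.toℚᵘ-fromℚᵘ (mkℚᵘ (+ a) b) ⟩
  mkℚᵘ (+ a) b
    ≤⟨ *≤* (ℤ.≤-trans (ℤ.≤-reflexive (sym (ℤ.pos-* a (suc d))))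
           (ℤ.≤-trans (ℤ.+≤+ ad≤cb) (ℤ.≤-reflexive (ℤ.pos-* c (suc b))))) ⟩
  mkℚᵘ (+ c) d       ≃⟨ ℚ.toℚᵘ-fromℚᵘ (mkℚᵘ (+ c) d) ⟨
  toℚᵘ (+ c / suc d) ∎)
  where open ℚᵘ.≤-Reasoning

/-≡⁺ : ∀ a b c d → a ℕ.* suc d ≡ c ℕ.* suc b → + a / suc b ≡ + c / suc d
/-≡⁺ a b c d ad≡cb = ℚ.fromℚᵘ-cong {mkℚᵘ (+ a) b} {mkℚᵘ (+ c) d}
  (*≡* (trans (sym (ℤ.pos-* a (suc d))) (trans (cong +_ ad≡cb) (ℤ.pos-* c (suc b)))))

/-≡⁻ : ∀ a b c d → + a / suc b ≡ + c / suc d → a ℕ.* suc d ≡ c ℕ.* suc b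
/-≡⁻ a b c d eq with ℚ.fromℚᵘ-injective {mkℚᵘ (+ a) b} {mkℚᵘ (+ c) d} eq
... | *≡* ad≡cb =
  ℤ.+-injective (trans (ℤ.pos-* a (suc d)) (trans ad≡cb (sym (ℤ.pos-* c (suc b)))))

-- The bound on `av₁` and its equality case

module _ {n} (G : Graph n) where

  totalDeficit≡0⇔S₁*2≡ : totalDeficit G ≡ 0 ⇔ (S₁ G ℕ.* 2 ≡ (n ℕ.+ 2) ℕ.* σ₁ G)
  totalDeficit≡0⇔S₁*2≡ = mk⇔
    (λ D≡0 → trans (sym (ℕ.+-identityʳ _))
      (trans (cong (S₁ G ℕ.* 2 ℕ.+_) (sym D≡0)) (double-count G)))
    (λ eq → ℕ.+-cancelˡ-≡ (S₁ G ℕ.* 2) _ _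
      (trans (double-count G) (trans (sym eq) (sym (ℕ.+-identityʳ _)))))

  av₁-≤ : av₁ G ≤ + (n ℕ.+ 2) / 2
  av₁-≤ with σ₁ G | ℕ.m+n≤o⇒m≤o (S₁ G ℕ.* 2) (ℕ.≤-reflexive (double-count G))
  -- The default value `0ℚ` is compared as the fraction 0/1.
  ... | zero  | _  = /-≤⁺ 0 0 (n ℕ.+ 2) 1 ℕ.z≤n
  ... | suc k | le = /-≤⁺ (S₁ G) k (n ℕ.+ 2) 1 le

  -- Equality forces deficit 0, so a member of the family grows within it to `⊤`.
  av₁≡⇒onlyEdge : av₁ G ≡ + (n ℕ.+ 2) / 2 → ∃₂ (IsOnlyEdge G)
  av₁≡⇒onlyEdge eq = go (σ₁ G) refl eq
    where
    go : ∀ k → σ₁ G ≡ k → average (S₁ G) k ≡ + (n ℕ.+ 2) / 2 → ∃₂ (IsOnlyEdge G)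
    -- The default average 0 would force `n ℕ.+ 2 ≡ 0`.
    go zero    _  av≡
      with ℕ.m+n≡0⇒n≡0 n (trans (sym (ℕ.*-identityʳ _)) (sym (/-≡⁻ 0 0 (n ℕ.+ 2) 1 av≡)))
    ... | ()
    go (suc k) σ≡ av≡ with count≡suc⇒member G σ≡
    ... | S , ni = nearlyIndependent⊤⇒onlyEdge G
      (addition-closed⇒⊤ (NearlyIndependent₁ G) (totalDeficit≡0⇒addition-closed G D≡0) S ni)
      where
      D≡0 : totalDeficit G ≡ 0
      D≡0 = Equivalence.from totalDeficit≡0⇔S₁*2≡
        (trans (/-≡⁻ (S₁ G) k (n ℕ.+ 2) 1 av≡) (cong ((n ℕ.+ 2) ℕ.*_) (sym σ≡)))

  onlyEdge⇒av₁≡ : ∃₂ (IsOnlyEdge G) → av₁ G ≡ + (n ℕ.+ 2) / 2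
  onlyEdge⇒av₁≡ (u , v , only) = go (σ₁ G) refl
    where
    ni⊤ : NearlyIndependent₁ G ⊤
    ni⊤ = onlyEdge⇒nearlyIndependent⊤ G only

    S₁*2≡ : S₁ G ℕ.* 2 ≡ (n ℕ.+ 2) ℕ.* σ₁ G
    S₁*2≡ = Equivalence.to totalDeficit≡0⇔S₁*2≡
      (addition-closed⇒totalDeficit≡0 G (nearlyIndependent⊤⇒addition-closed G ni⊤))

    go : ∀ k → σ₁ G ≡ k → average (S₁ G) k ≡ + (n ℕ.+ 2) / 2
    -- The default average is excluded, since `⊤` itself is counted.
    go zero    σ≡ = contradiction σ≡ (member⇒count≢0 G ni⊤)
    go (suc k) σ≡ = /-≡⁺ (S₁ G) k (n ℕ.+ 2) 1 (trans S₁*2≡ (cong ((n ℕ.+ 2) ℕ.*_) σ≡))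

mainTheorem9 : (n : ℕ) → 6 ≤ℕ n → (G : Graph n) →
    (av₁ G ≤ + n / 2 + 1ℚ) ×
    ((av₁ G ≡ + n / 2 + 1ℚ) ⇔ (G ≅ complete 2 ∪ (n ∸ 2) · complete 1))
mainTheorem9 n 6≤n G rewrite +n/2+1≡+[n+2]/2 n = av₁-≤ G , mk⇔ to from
  where
  H = complete 2 ∪ (n ∸ 2) · complete 1

  -- The bound `6≤n` gives `2 ≤ n`, which makes the truncated subtraction exact; the factor 1 is the
  -- order of `complete 1`.
  order : n ≡ 2 ℕ.+ (n ∸ 2) ℕ.* 1
  order = sym (trans (cong (2 ℕ.+_) (ℕ.*-identityʳ (n ∸ 2)))
    (ℕ.m+[n∸m]≡n (ℕ.≤-trans (s≤s (s≤s ℕ.z≤n)) 6≤n)))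

  to : av₁ G ≡ + (n ℕ.+ 2) / 2 → G ≅ H
  to eq with av₁≡⇒onlyEdge G eq
  ... | _ , _ , only = onlyEdge⇒≅ order only (K₂∪isolated-onlyEdge (n ∸ 2))

  from : G ≅ H → av₁ G ≡ + (n ℕ.+ 2) / 2
  from G≅H = onlyEdge⇒av₁≡ G (≅⇒onlyEdge G≅H (K₂∪isolated-onlyEdge (n ∸ 2)))
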